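{- For any natural number $n \geq 1$, $\{\omega \cdot n, \omega^\star \cdot n\} \leq_c \{\omega^2 \cdot n, (\omega^2)^\star \cdot n\}$.
   Context: Structures have domains contained in $\omega$. For countable structures $\mathcal{A},\mathcal{B}$, the class $\{\mathcal{A},\mathcal{B}\}$ denotes the class of all structures (with domain $\subseteq\omega$) isomorphic to $\mathcal{A}$ or to $\mathcal{B}$. Linear orders are in the language $\{<\}$; $L^\star$ is the reverse of a linear order $L$; $\omega\cdot n$, $\omega^2\cdot n$ are ordinal order types. An enumeration operator $\Gamma$ is a c.e. set of pairs $(\alpha,\varphi)$ with $\alpha$ a finite set of basic (atomic or negated atomic) sentences of the input language with constants from $\omega$ and $\varphi$ a basic sentence of the output language with constants from $\omega$; $\Gamma(X)=\{\varphi : (\alpha,\varphi)\in\Gamma,\ \alpha\subseteq X\}$. $\Gamma$ is a computable embedding of $\mathcal{K}_0$ into $\mathcal{K}_1$ ($\mathcal{K}_0\leq_c\mathcal{K}_1$) if for every $\mathcal{A}\in\mathcal{K}_0$, $\Gamma$ applied to the atomic diagram of $\mathcal{A}$ is the atomic diagram of a structure $\Gamma(\mathcal{A})\in\mathcal{K}_1$, and for all $\mathcal{A},\mathcal{B}\in\mathcal{K}_0$, $\mathcal{A}\cong\mathcal{B}$ iff $\Gamma(\mathcal{A})\cong\Gamma(\mathcal{B})$. -}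

module Defs where

open import Data.Fin.Base using (Fin)
import Data.Fin.Properties as Fin
open import Data.List.Base using (List; []; _∷_)
open import Data.List.Relation.Unary.All using (All)
open import Data.Nat.Base using (ℕ; zero; suc; _+_; _<_)
import Data.Nat.Properties as ℕ
open import Data.Product.Base using (Σ; ∃; _×_; _,_; proj₁)
open import Data.Product.Relation.Binary.Lex.Strict using (×-strictTotalOrder)
open import Data.Sum.Base using (_⊎_)
open import Data.Vec.Base using (Vec; []; _∷_; lookup)
open import Data.Vec.Relation.Binary.Pointwise.Inductive using (Pointwise)
open import Function.Base using (_on_)
open import Function.Bundles using (_⇔_)
open import Level using (Level; 0ℓ)
open import Relation.Binary.Bundles using (StrictTotalOrder)
open import Relation.Binary.Bundles.Raw using (RawRelation)
import Relation.Binary.Construct.Flip.EqAndOrd as Flip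
open import Relation.Binary.Core using (Rel)
open import Relation.Binary.Morphism.Structures using (IsOrderIsomorphism)
open import Relation.Binary.PropositionalEquality.Core using (_≡_)
open import Relation.Nullary.Negation.Core using (¬_)
open import Relation.Unary using (Pred; _∈_; _≐_)

------------------------------------------------------------------------
-- Partial recursive functions and c.e. sets

data Rec : ℕ → Set where
  zer  : Rec 0
  succ : Rec 1
  proj : ∀ {n} → Fin n → Rec n
  comp : ∀ {m n} → Rec m → Vec (Rec n) m → Rec n
  prec : ∀ {n} → Rec n → Rec (suc (suc n)) → Rec (suc n)
  mu   : ∀ {n} → Rec (suc n) → Rec n

-- f [ xs ]⇓ y : the computation of f on xs halts with output y.

infix 4 _[_]⇓_

data _[_]⇓_ : ∀ {n} → Rec n → Vec ℕ n → ℕ → Set where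
  zer⇓      : zer [ [] ]⇓ 0
  succ⇓     : ∀ {x} → succ [ x ∷ [] ]⇓ suc x
  proj⇓     : ∀ {n} {i : Fin n} {xs} → proj i [ xs ]⇓ lookup xs i
  comp⇓     : ∀ {m n} {f : Rec m} {gs : Vec (Rec n) m} {xs ys z} →
              Pointwise (λ g y → g [ xs ]⇓ y) gs ys →
              f [ ys ]⇓ z →
              comp f gs [ xs ]⇓ z
  prec-zero : ∀ {n} {f : Rec n} {g xs y} →
              f [ xs ]⇓ y →
              prec f g [ zero ∷ xs ]⇓ y
  prec-suc  : ∀ {n} {f : Rec n} {g k xs y z} →
              prec f g [ k ∷ xs ]⇓ y →
              g [ k ∷ y ∷ xs ]⇓ z →
              prec f g [ suc k ∷ xs ]⇓ z
  mu⇓       : ∀ {n} {f : Rec (suc n)} {xs y} →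
              f [ y ∷ xs ]⇓ 0 →
              (∀ z → z < y → ∃ λ k → f [ z ∷ xs ]⇓ suc k) →
              mu f [ xs ]⇓ y

-- A set of objects Gödel-numbered by `code` is c.e. when it is the set of
-- objects on whose codes some partial recursive function halts.

CE : {A : Set} → (A → ℕ) → Pred A 0ℓ → Set
CE code S = Σ (Rec 1) λ f → S ≐ λ a → ∃ λ y → f [ code a ∷ [] ]⇓ y

------------------------------------------------------------------------
-- Basic sentences in the language {<} with constants from ω

-- Equality is a logical symbol, so equations are atomic sentences.

data Atom : Set where
  lt eq : ℕ → ℕ → Atom

data Basic : Set where
  pos neg : Atom → Basic

triangle : ℕ → ℕ
triangle zero    = 0
triangle (suc n) = suc n + triangle n

-- Cantor's pairing function.
pair : ℕ → ℕ → ℕ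
pair a b = triangle (a + b) + b

codeAtom : Atom → ℕ
codeAtom (lt a b) = pair 0 (pair a b)
codeAtom (eq a b) = pair 1 (pair a b)

codeBasic : Basic → ℕ
codeBasic (pos φ) = pair 0 (codeAtom φ)
codeBasic (neg φ) = pair 1 (codeAtom φ)

codeList : List Basic → ℕ
codeList []      = 0
codeList (φ ∷ α) = suc (pair (codeBasic φ) (codeList α))

codeRule : List Basic × Basic → ℕ
codeRule (α , φ) = pair (codeList α) (codeBasic φ)

------------------------------------------------------------------------
-- Structures in the language {<} with domain contained in ω

-- Only the restriction of Less to Dom matters: every definition below
-- consults Less at elements of Dom only.

record Structure : Set₁ where
  field
    Dom  : Pred ℕ 0ℓ
    Less : Rel ℕ 0ℓ

  rawRelation : RawRelation 0ℓ 0ℓ 0ℓ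
  rawRelation = record
    { Carrier = Σ ℕ Dom
    ; _≈_     = _≡_ on proj₁
    ; _∼_     = Less on proj₁
    }

open Structure

constantsIn : Pred ℕ 0ℓ → Atom → Set
constantsIn D (lt a b) = D a × D b
constantsIn D (eq a b) = D a × D b

holds : Structure → Atom → Set
holds 𝓐 (lt a b) = Less 𝓐 a b
holds 𝓐 (eq a b) = a ≡ b

-- The atomic diagram.
Diagram : Structure → Pred Basic 0ℓ
Diagram 𝓐 (pos φ) = constantsIn (Dom 𝓐) φ × holds 𝓐 φ
Diagram 𝓐 (neg φ) = constantsIn (Dom 𝓐) φ × ¬ holds 𝓐 φ

------------------------------------------------------------------------
-- Isomorphism, and the classes {𝓐, 𝓑}

infix 4 _≅_

_≅_ : ∀ {a b ℓ₁ ℓ₂ ℓ₃ ℓ₄ : Level} →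
      RawRelation a ℓ₁ ℓ₂ → RawRelation b ℓ₃ ℓ₄ → Set _
R ≅ S = Σ (R.Carrier → S.Carrier) (IsOrderIsomorphism R._≈_ S._≈_ R._∼_ S._∼_)
  where
  module R = RawRelation R
  module S = RawRelation S

infix 5 ｛_,_｝

｛_,_｝ : StrictTotalOrder 0ℓ 0ℓ 0ℓ → StrictTotalOrder 0ℓ 0ℓ 0ℓ →
        Pred Structure 0ℓ
｛ L , M ｝ 𝓐 = rawRelation 𝓐 ≅ StrictTotalOrder.rawRelation L
             ⊎ rawRelation 𝓐 ≅ StrictTotalOrder.rawRelation M

------------------------------------------------------------------------
-- Computable embeddings

-- Finite sets α are presented by lists; `apply` depends only on their members.

record EnumerationOperator : Set₁ where
  field
    rules : Pred (List Basic × Basic) 0ℓ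
    ce    : CE codeRule rules

  apply : Pred Basic 0ℓ → Pred Basic 0ℓ
  apply X φ = ∃ λ α → (α , φ) ∈ rules × All X α

open EnumerationOperator

-- Γ ∶ 𝓐 ↦ 𝓑 says that Γ(𝓐) = 𝓑.

infix 4 _∶_↦_

_∶_↦_ : EnumerationOperator → Structure → Structure → Set
Γ ∶ 𝓐 ↦ 𝓑 = apply Γ (Diagram 𝓐) ≐ Diagram 𝓑

-- Since a diagram determines its structure, quantifying over all 𝓒, 𝓓 with
-- Γ(𝓐) = 𝓒 and Γ(𝓑) = 𝓓 in `invariant` only names Γ(𝓐) and Γ(𝓑).

record IsComputableEmbedding (Γ : EnumerationOperator)
                             (K₀ K₁ : Pred Structure 0ℓ) : Set₁ where
  field
    image     : ∀ 𝓐 → 𝓐 ∈ K₀ → ∃ λ 𝓑 → 𝓑 ∈ K₁ × Γ ∶ 𝓐 ↦ 𝓑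
    invariant : ∀ 𝓐 𝓑 → 𝓐 ∈ K₀ → 𝓑 ∈ K₀ →
                ∀ 𝓒 𝓓 → Γ ∶ 𝓐 ↦ 𝓒 → Γ ∶ 𝓑 ↦ 𝓓 →
                (rawRelation 𝓐 ≅ rawRelation 𝓑) ⇔ (rawRelation 𝓒 ≅ rawRelation 𝓓)

infix 4 _≤c_

_≤c_ : Pred Structure 0ℓ → Pred Structure 0ℓ → Set₁
K₀ ≤c K₁ = ∃ λ Γ → IsComputableEmbedding Γ K₀ K₁

------------------------------------------------------------------------
-- Order types

LinearOrder : Set₁
LinearOrder = StrictTotalOrder 0ℓ 0ℓ 0ℓ

ω : LinearOrder
ω = ℕ.<-strictTotalOrder

finite : ℕ → LinearOrder
finite = Fin.<-strictTotalOrder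

infixl 7 _·_

-- M-many copies of L: the M-coordinate is compared first.
_·_ : LinearOrder → LinearOrder → LinearOrder
L · M = ×-strictTotalOrder M L

infix 8 _⋆

_⋆ : LinearOrder → LinearOrder
_⋆ = Flip.strictTotalOrder

ω² : LinearOrder
ω² = ω · ω

{-# OPTIONS --safe #-}
module Submission where

-- The operator sends 𝓐 to 𝓐 · 𝓐, the lexicographic order on pairs of elements.
-- Since n · ω ≅ ω and n · ω⋆ ≅ ω⋆, associativity of the product gives
-- (ω · n) · (ω · n) ≅ (ω · ω) · n, and likewise for ω⋆.  The orders ω · n and
-- ω² · n are well-founded while ω⋆ · n and (ω²)⋆ · n descend infinitely, so
-- isomorphism of the inputs and of the outputs both just say on which side
-- the structures lie.

open import Defs
open import Data.Fin.Base as Fin using (Fin; zero; suc; opposite; toℕ)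
import Data.Fin.Induction as Fin
open import Data.Fin.Patterns
import Data.Fin.Properties as Fin
open import Data.List.Base using (List; []; _∷_; map)
open import Data.List.Membership.Propositional using () renaming (_∈_ to _∈ₗ_)
open import Data.List.Relation.Unary.All using (All; []; _∷_)
open import Data.List.Relation.Unary.Any using (here; there)
open import Data.Nat.Base using (ℕ; zero; suc; pred; _+_; _*_; _∸_; _<_; _≤_; _≥_; z≤n; s≤s; s<s; s<s⁻¹)
open import Data.Nat.DivMod using (_divMod_; result)
import Data.Nat.Induction as ℕ
open import Data.Nat.ListAction using (product)
import Data.Nat.Properties as ℕ
open import Data.Product.Base using (Σ; ∃; ∃₂; _×_; _,_; proj₁; proj₂; uncurry; map₁)
open import Data.Product.Relation.Binary.Lex.Strict using (×-Lex; ×-wellFounded')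
open import Data.Sum.Base as Sum using (inj₁; inj₂)
open import Data.Vec.Base using (Vec; []; _∷_; lookup; head; tail; tabulate; _++_)
open import Data.Vec.Relation.Binary.Pointwise.Inductive using (Pointwise; []; _∷_)
open import Function.Base using (_∘_; id)
open import Function.Bundles using (_⇔_; mk⇔; Equivalence)
open import Induction.InfiniteDescent using (descent∧wf⇒empty)
open import Induction.WellFounded using (WellFounded)
open import Level using (Level)
open import Relation.Binary.Bundles using (StrictTotalOrder)
open import Relation.Binary.Bundles.Raw using (RawRelation)
open import Relation.Binary.Core using (_Preserves_⟶_)
open import Relation.Binary.Definitions using (Transitive; tri<; tri≈; tri>)
open import Relation.Binary.Morphism.Construct.Composition using (isOrderIsomorphism)
import Relation.Binary.Morphism.OrderMonomorphism as OrderMonomorphism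
open import Relation.Binary.Morphism.Structures using (IsOrderIsomorphism)
open import Relation.Binary.PropositionalEquality
open import Relation.Nullary.Decidable.Core using (yes; no)
open import Relation.Nullary.Negation.Core using (¬_; contradiction)
open import Relation.Unary using (_≐_)

open Structure
open EnumerationOperator

-- Linear orders and their products

≅-trans : ∀ {a b c ℓ₁ ℓ₂ ℓ₃ ℓ₄ ℓ₅ ℓ₆ : Level} {R : RawRelation a ℓ₁ ℓ₂}
          {S : RawRelation b ℓ₃ ℓ₄} {T : RawRelation c ℓ₅ ℓ₆} →
          Transitive (RawRelation._≈_ T) → R ≅ S → S ≅ T → R ≅ T
≅-trans trans-≈ (f , f-iso) (g , g-iso) = g ∘ f , isOrderIsomorphism trans-≈ f-iso g-iso

infix 4 _≃_

_≃_ : LinearOrder → LinearOrder → Set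
L ≃ M = StrictTotalOrder.rawRelation L ≅ StrictTotalOrder.rawRelation M

-- All laws are carried over from `L` along `f`, so `R` may be a bare relation, as that of a
-- `Structure` is.
≅-sym : ∀ {a ℓ₁ ℓ₂ : Level} {R : RawRelation a ℓ₁ ℓ₂} (L : LinearOrder) →
        R ≅ StrictTotalOrder.rawRelation L → StrictTotalOrder.rawRelation L ≅ R
≅-sym {R = R} L (f , f-iso) = g , record
  { isOrderMonomorphism = record
    { isOrderHomomorphism = record
      { cong = λ {x} {y} x≈y → F.injective
          (L.Eq.trans (fg≈ x) (L.Eq.trans x≈y (L.Eq.sym (fg≈ y))))
      ; mono = λ {x} {y} x<y → F.cancel
          (L.<-respˡ-≈ (L.Eq.sym (fg≈ x)) (L.<-respʳ-≈ (L.Eq.sym (fg≈ y)) x<y))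
      }
    ; injective = λ {x} {y} gx≈gy →
        L.Eq.trans (L.Eq.sym (fg≈ x)) (L.Eq.trans (F.cong gx≈gy) (fg≈ y))
    ; cancel = λ {x} {y} gx<gy →
        L.<-respˡ-≈ (fg≈ x) (L.<-respʳ-≈ (fg≈ y) (F.mono gx<gy))
    }
  ; surjective = λ x → f x , λ {y} y≈fx → F.injective (L.Eq.trans (fg≈ y) y≈fx)
  }
  where
  module L = StrictTotalOrder L
  module F = IsOrderIsomorphism f-iso

  g : L.Carrier → RawRelation.Carrier R
  g y = proj₁ (F.surjective y)

  fg≈ : ∀ y → f (g y) L.≈ y
  -- Surjectivity speaks of every point equivalent to `g y`; that `g y` is one of them follows from
  -- injectivity of `f`.
  fg≈ y = proj₂ (F.surjective y) (F.injective L.Eq.refl)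

≃-trans : ∀ L M N → L ≃ M → M ≃ N → L ≃ N
≃-trans _ _ N = ≅-trans (StrictTotalOrder.Eq.trans N)

module _ (L M : LinearOrder) where

  private
    module L = StrictTotalOrder L
    module M = StrictTotalOrder M

  -- By trichotomy in `L`: `f` carries each unwanted case into `M`, where it contradicts
  -- irreflexivity or asymmetry.
  strictMono⇒≃ : (f : L.Carrier → M.Carrier) →
                 f Preserves L._≈_ ⟶ M._≈_ → f Preserves L._<_ ⟶ M._<_ →
                 (∀ y → ∃ λ x → f x M.≈ y) → L ≃ M
  strictMono⇒≃ f f-cong f-mono f-surj = f , record
    { isOrderMonomorphism = record
      { isOrderHomomorphism = record { cong = f-cong ; mono = f-mono }
      ; injective = injective
      ; cancel = cancel
      }
    ; surjective = λ y → let x , fx≈y = f-surj y in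
        x , λ z≈x → M.Eq.trans (f-cong z≈x) fx≈y
    }
    where
    injective : ∀ {x y} → f x M.≈ f y → x L.≈ y
    injective {x} {y} fx≈fy with L.compare x y
    ... | tri< x<y _ _ = contradiction (f-mono x<y) (M.irrefl fx≈fy)
    ... | tri≈ _ x≈y _ = x≈y
    ... | tri> _ _ y<x = contradiction (f-mono y<x) (M.irrefl (M.Eq.sym fx≈fy))

    cancel : ∀ {x y} → f x M.< f y → x L.< y
    cancel {x} {y} fx<fy with L.compare x y
    ... | tri< x<y _ _ = x<y
    ... | tri≈ _ x≈y _ = contradiction fx<fy (M.irrefl (f-cong x≈y))
    ... | tri> _ _ y<x = contradiction fx<fy (M.asym (f-mono y<x))

  -- An isomorphism would pull `d` back to a descending sequence in `L`; `P` is the property of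
  -- lying on that sequence.
  wellFounded⇒≄ : WellFounded L._<_ → (d : ℕ → M.Carrier) →
                  (∀ k → d (suc k) M.< d k) → ¬ L ≃ M
  wellFounded⇒≄ wf d d-desc L≃M =
    descent∧wf⇒empty {P = λ x → ∃ λ k → x ≡ g (d k)}
      (λ where (k , refl) → g (d (suc k)) , G.mono (d-desc k) , suc k , refl)
      wf (g (d 0)) (0 , refl)
    where
    g = proj₁ (≅-sym M L≃M)
    module G = IsOrderIsomorphism (proj₂ (≅-sym M L≃M))

≃-refl : ∀ L → L ≃ L
≃-refl L = strictMono⇒≃ L L id id id (λ y → y , StrictTotalOrder.Eq.refl L)

·-cong : ∀ K K′ L L′ → K ≃ K′ → L ≃ L′ → K · L ≃ K′ · L′
·-cong K K′ L L′ (f , f-iso) (g , g-iso) =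
  strictMono⇒≃ (K · L) (K′ · L′)
    (λ (y , x) → g y , f x)
    (λ (p , q) → G.cong p , F.cong q)
    (Sum.map G.mono (λ (p , q) → G.cong p , F.mono q))
    (λ (y , x) → let y₀ , y₀↦y = G.surjective y ; x₀ , x₀↦x = F.surjective x in
      (y₀ , x₀) , y₀↦y (StrictTotalOrder.Eq.refl L) , x₀↦x (StrictTotalOrder.Eq.refl K))
  where
  module F = IsOrderIsomorphism f-iso
  module G = IsOrderIsomorphism g-iso

-- Since `_·_` stores its right factor first, the elements are `(z , y , x)` and `((z , y) , x)`,
-- both compared at `z`, then `y`, then `x`.
·-assoc : ∀ K L M → (K · L) · M ≃ K · (L · M)
·-assoc K L M = strictMono⇒≃ ((K · L) · M) (K · (L · M))
  (λ (z , y , x) → (z , y) , x)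
  (λ (p , q , r) → (p , q) , r)
  (λ where
    (inj₁ p)              → inj₁ (inj₁ p)
    (inj₂ (p , inj₁ q))   → inj₁ (inj₂ (p , q))
    (inj₂ (p , inj₂ (q , r))) → inj₂ ((p , q) , r))
  (λ ((z , y) , x) → (z , y , x) , StrictTotalOrder.Eq.refl (K · (L · M)))

-- Reversal acts on each coordinate separately, so the identity serves; only the equality of leading
-- coordinates has to be turned round.
⋆-· : ∀ K L → K ⋆ · L ⋆ ≃ (K · L) ⋆
⋆-· K L = strictMono⇒≃ (K ⋆ · L ⋆) ((K · L) ⋆) id id
  (Sum.map₂ (map₁ (StrictTotalOrder.Eq.sym L)))
  (λ p → p , StrictTotalOrder.Eq.refl (K · L))

-- Reassociate to `((K · N) · K) · N`, then to `(K · (N · K)) · N`, where the inner `N · K`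
-- collapses to `K`.
square-≃ : ∀ K N → N · K ≃ K → (K · N) · (K · N) ≃ (K · K) · N
square-≃ K N N·K≃K =
  ≃-trans ((K · N) · (K · N)) (((K · N) · K) · N) ((K · K) · N)
    (≅-sym ((K · N) · (K · N)) (·-assoc (K · N) K N))
    (·-cong ((K · N) · K) (K · K) N N
      (≃-trans ((K · N) · K) (K · (N · K)) (K · K)
        (·-assoc K N K)
        (·-cong K K (N · K) K (≃-refl K) N·K≃K))
      (≃-refl N))

-- Finite factors absorbed by `ω` and `ω ⋆`

m*n+j-mono : ∀ {n x y j k} → x < y → j < n → x * n + j < y * n + k
m*n+j-mono {n} {x} {y} {j} {k} x<y j<n = begin-strict
  x * n + j  <⟨ ℕ.+-monoʳ-< (x * n) j<n ⟩
  x * n + n  ≡⟨ ℕ.+-comm (x * n) n ⟩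
  suc x * n  ≤⟨ ℕ.*-monoˡ-≤ n x<y ⟩
  y * n      ≤⟨ ℕ.m≤m+n (y * n) k ⟩
  y * n + k  ∎
  where open ℕ.≤-Reasoning

-- Division with remainder by `suc m`: the quotient names a block of that length, the remainder a
-- place in it.
finite·ω≃ω : ∀ m → finite (suc m) · ω ≃ ω
finite·ω≃ω m = strictMono⇒≃ (finite n · ω) ω
  (λ (x , j) → x * n + toℕ j)
  (λ where (refl , refl) → refl)
  mono
  (λ y → let result q r y≡ = y divMod n in
    (q , r) , trans (ℕ.+-comm (q * n) (toℕ r)) (sym y≡))
  where
  n = suc m

  mono : (λ (x , j) → x * n + toℕ j) Preserves StrictTotalOrder._<_ (finite n · ω) ⟶ _<_
  mono {_ , j} (inj₁ x<y)          = m*n+j-mono x<y (Fin.toℕ<n j)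
  mono {x , _} (inj₂ (refl , j<k)) = ℕ.+-monoʳ-< (x * n) j<k

opposite-anti-< : ∀ {n} {j k : Fin n} → j Fin.< k → opposite k Fin.< opposite j
opposite-anti-< {n} {j} {k} j<k = begin-strict
  toℕ (opposite k)   ≡⟨ Fin.opposite-prop k ⟩
  n ∸ suc (toℕ k)    <⟨ ℕ.∸-monoʳ-< (s<s j<k) (Fin.toℕ<n k) ⟩
  n ∸ suc (toℕ j)    ≡⟨ Fin.opposite-prop j ⟨
  toℕ (opposite j)   ∎
  where open ℕ.≤-Reasoning

-- Later places in a block must receive smaller numbers, since the target is reversed; hence `j` is
-- counted from the end of its block.
finite·ω⋆≃ω⋆ : ∀ m → finite (suc m) · ω ⋆ ≃ ω ⋆
finite·ω⋆≃ω⋆ m = strictMono⇒≃ (finite n · ω ⋆) (ω ⋆)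
  (λ (x , j) → x * n + toℕ (opposite j))
  (λ where (refl , refl) → refl)
  mono
  (λ y → let result q r y≡ = y divMod n in
    (q , opposite r) ,
    trans (cong (λ i → q * n + toℕ i) (Fin.opposite-involutive r))
          (trans (ℕ.+-comm (q * n) (toℕ r)) (sym y≡)))
  where
  n = suc m

  mono : (λ (x , j) → x * n + toℕ (opposite j)) Preserves
         StrictTotalOrder._<_ (finite n · ω ⋆) ⟶ StrictTotalOrder._<_ (ω ⋆)
  mono {_} {_ , k} (inj₁ y<x)      = m*n+j-mono y<x (Fin.toℕ<n (opposite k))
  mono {x , _} (inj₂ (refl , j<k)) = ℕ.+-monoʳ-< (x * n) (opposite-anti-< j<k)

-- Well-foundedness and non-isomorphism

·-wellFounded : ∀ K L → WellFounded (StrictTotalOrder._<_ K) →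
                WellFounded (StrictTotalOrder._<_ L) →
                WellFounded (StrictTotalOrder._<_ (K · L))
·-wellFounded K L wf-K wf-L =
  ×-wellFounded' L.Eq.trans L.<-respʳ-≈ wf-L wf-K
  where module L = StrictTotalOrder L

-- The numbers 0, 1, 2, ... in the first copy of `ω ⋆` descend forever; a first copy exists because
-- `suc m` is positive.
ω·n≄ω⋆·n : ∀ m → ¬ ω · finite (suc m) ≃ ω ⋆ · finite (suc m)
ω·n≄ω⋆·n m = wellFounded⇒≄ (ω · finite (suc m)) (ω ⋆ · finite (suc m))
  (·-wellFounded ω (finite (suc m)) ℕ.<-wellFounded Fin.<-wellFounded)
  (λ k → Fin.zero , k)
  (λ k → inj₂ (refl , ℕ.n<1+n k))

ω²·n≄ω²⋆·n : ∀ m → ¬ ω² · finite (suc m) ≃ ω² ⋆ · finite (suc m)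
ω²·n≄ω²⋆·n m = wellFounded⇒≄ (ω² · finite (suc m)) (ω² ⋆ · finite (suc m))
  (·-wellFounded ω² (finite (suc m))
    (·-wellFounded ω ω ℕ.<-wellFounded ℕ.<-wellFounded) Fin.<-wellFounded)
  -- The descent runs through the outer coordinate of `ω²`, with the inner one held at 0.
  (λ k → Fin.zero , k , 0)
  (λ k → inj₂ (refl , inj₁ (ℕ.n<1+n k)))

-- Computable functions and semidecidability

mutual
  -- Lets a halting `mu` be read as an actual zero of the function searched. For `mu` itself, were
  -- the two results distinct, the smaller would be assigned both 0 and a successor.
  ⇓-deterministic : ∀ {n} {f : Rec n} {xs y z} → f [ xs ]⇓ y → f [ xs ]⇓ z → y ≡ z
  ⇓-deterministic zer⇓ zer⇓ = refl
  ⇓-deterministic succ⇓ succ⇓ = refl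
  ⇓-deterministic proj⇓ proj⇓ = refl
  ⇓-deterministic (comp⇓ gs f) (comp⇓ gs′ f′)
    with refl ← ⇓-deterministic* gs gs′ = ⇓-deterministic f f′
  ⇓-deterministic (prec-zero f) (prec-zero f′) = ⇓-deterministic f f′
  ⇓-deterministic (prec-suc r g) (prec-suc r′ g′)
    with refl ← ⇓-deterministic r r′ = ⇓-deterministic g g′
  ⇓-deterministic (mu⇓ {y = y} f below) (mu⇓ {y = z} f′ below′) with ℕ.<-cmp y z
  ... | tri≈ _ y≡z _ = y≡z
  ... | tri< y<z _ _ with () ← ⇓-deterministic f (proj₂ (below′ y y<z))
  ... | tri> _ _ z<y with () ← ⇓-deterministic f′ (proj₂ (below z z<y))

  ⇓-deterministic* : ∀ {m n} {gs : Vec (Rec n) m} {xs ys zs} →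
                     Pointwise (λ g y → g [ xs ]⇓ y) gs ys →
                     Pointwise (λ g y → g [ xs ]⇓ y) gs zs → ys ≡ zs
  ⇓-deterministic* [] [] = refl
  ⇓-deterministic* (p ∷ ps) (q ∷ qs) =
    cong₂ _∷_ (⇓-deterministic p q) (⇓-deterministic* ps qs)

-- A total function travels with its program, so that the combinators below build programs and their
-- correctness proofs together.
record Computable {n} (F : Vec ℕ n → ℕ) : Set where
  constructor _,_
  field
    program  : Rec n
    computes : ∀ xs → program [ xs ]⇓ F xs

record Computable* {m n} (F : Vec ℕ n → Vec ℕ m) : Set where
  constructor _,_
  field
    programs : Vec (Rec n) m
    computes : ∀ xs → Pointwise (λ g y → g [ xs ]⇓ y) programs (F xs)

open Computable using (program)

-- `primrecᶜ` yields a function written with `primrec`, `head` and `tail`; this exchanges it for the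
-- intended one, with only pointwise equality to prove.
resp-≗ : ∀ {n} {F G : Vec ℕ n → ℕ} → F ≗ G → Computable F → Computable G
resp-≗ F≗G (f , f⇓) = f , λ xs → subst (f [ xs ]⇓_) (F≗G xs) (f⇓ xs)

[]ᶜ : ∀ {n} → Computable* {n = n} (λ _ → [])
[]ᶜ = [] , λ _ → []

infixr 5 _∷ᶜ_

_∷ᶜ_ : ∀ {m n} {F : Vec ℕ n → ℕ} {G : Vec ℕ n → Vec ℕ m} →
       Computable F → Computable* G → Computable* (λ xs → F xs ∷ G xs)
(f , f⇓) ∷ᶜ (gs , gs⇓) = (f ∷ gs) , λ xs → f⇓ xs ∷ gs⇓ xs

infixr 9 _∘ᶜ_

_∘ᶜ_ : ∀ {m n} {F : Vec ℕ m → ℕ} {G : Vec ℕ n → Vec ℕ m} →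
       Computable F → Computable* G → Computable (λ xs → F (G xs))
(f , f⇓) ∘ᶜ (gs , gs⇓) = comp f gs , λ xs → comp⇓ (gs⇓ xs) (f⇓ _)

var : ∀ {n} (i : Fin n) → Computable (λ xs → lookup xs i)
var i = proj i , λ _ → proj⇓

-- Stated for an arbitrary reindexing `ρ` so that the induction can shorten `ys` while `xs` stays
-- fixed.
projections⇓ : ∀ {m n} (ρ : Fin m → Fin n) xs (ys : Vec ℕ m) →
               (∀ i → lookup xs (ρ i) ≡ lookup ys i) →
               Pointwise (λ g y → g [ xs ]⇓ y) (tabulate (proj ∘ ρ)) ys
projections⇓ ρ xs []       e = []
projections⇓ ρ xs (y ∷ ys) e =
  subst (proj (ρ zero) [ xs ]⇓_) (e zero) proj⇓ ∷ projections⇓ (ρ ∘ suc) xs ys (e ∘ suc)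

-- Strips counter, accumulator and search variable inside the recursion of `contractᶜ`.
tail³ᶜ : ∀ {n} → Computable* {n = suc (suc (suc n))} (λ xs → tail (tail (tail xs)))
tail³ᶜ = tabulate (λ i → proj (suc (suc (suc i)))) ,
  λ where xs@(_ ∷ _ ∷ _ ∷ ys) → projections⇓ (λ i → suc (suc (suc i))) xs ys (λ _ → refl)

idᶜ : ∀ {n} → Computable* {n = n} (λ xs → xs)
idᶜ = tabulate proj , λ xs → projections⇓ (λ i → i) xs xs (λ _ → refl)

sucᶜ : ∀ {n} {F : Vec ℕ n → ℕ} → Computable F → Computable (suc ∘ F)
sucᶜ (f , f⇓) = comp succ (f ∷ []) , λ xs → comp⇓ (f⇓ xs ∷ []) succ⇓

constᶜ : ∀ {n} k → Computable {n} (λ _ → k)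
constᶜ zero    = comp zer [] , λ _ → comp⇓ [] zer⇓
constᶜ (suc k) = sucᶜ (constᶜ k)

primrec : ∀ {n} → (Vec ℕ n → ℕ) → (Vec ℕ (suc (suc n)) → ℕ) → ℕ → Vec ℕ n → ℕ
primrec F G zero    xs = F xs
primrec F G (suc k) xs = G (k ∷ primrec F G k xs ∷ xs)

primrecᶜ : ∀ {n F G} → Computable {n} F → Computable G →
           Computable (λ xs → primrec F G (head xs) (tail xs))
primrecᶜ {n} {F} {G} (f , f⇓) (g , g⇓) = prec f g , λ where (k ∷ xs) → go k xs
  where
  go : ∀ k xs → prec f g [ k ∷ xs ]⇓ primrec F G k xs
  go zero    xs = prec-zero (f⇓ xs)
  go (suc k) xs = prec-suc (go k xs) (g⇓ _)

unary : ∀ {n} (h : ℕ → ℕ) → Computable (λ xs → h (head xs)) →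
        {F : Vec ℕ n → ℕ} → Computable F → Computable (λ xs → h (F xs))
unary h hᶜ f = hᶜ ∘ᶜ (f ∷ᶜ []ᶜ)

binary : ∀ {n} (_•_ : ℕ → ℕ → ℕ) → Computable (λ xs → head xs • head (tail xs)) →
         {F G : Vec ℕ n → ℕ} → Computable F → Computable G →
         Computable (λ xs → F xs • G xs)
binary _•_ •ᶜ f g = •ᶜ ∘ᶜ (f ∷ᶜ g ∷ᶜ []ᶜ)

infixl 6 _+ᶜ_ _∸ᶜ_
infixl 7 _*ᶜ_

_+ᶜ_ : ∀ {n} {F G : Vec ℕ n → ℕ} →
       Computable F → Computable G → Computable (λ xs → F xs + G xs)
_+ᶜ_ = binary _+_ (resp-≗ (λ where (x ∷ y ∷ []) → e x y) (primrecᶜ (var 0F) (sucᶜ (var 1F))))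
  where
  e : ∀ x y → primrec (λ xs → lookup xs 0F) (λ xs → suc (lookup xs 1F)) x (y ∷ []) ≡ x + y
  e zero    y = refl
  e (suc x) y = cong suc (e x y)

_*ᶜ_ : ∀ {n} {F G : Vec ℕ n → ℕ} →
       Computable F → Computable G → Computable (λ xs → F xs * G xs)
_*ᶜ_ = binary _*_ (resp-≗ (λ where (x ∷ y ∷ []) → e x y) (primrecᶜ (constᶜ 0) (var 2F +ᶜ var 1F)))
  where
  e : ∀ x y → primrec (λ _ → 0) (λ xs → lookup xs 2F + lookup xs 1F) x (y ∷ []) ≡ x * y
  e zero    y = refl
  e (suc x) y = cong (y +_) (e x y)

predᶜ : ∀ {n} {F : Vec ℕ n → ℕ} → Computable F → Computable (pred ∘ F)
predᶜ = unary pred (resp-≗ (λ where (zero ∷ []) → refl; (suc x ∷ []) → refl)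
                            (primrecᶜ (constᶜ 0) (var 0F)))

_∸ᶜ_ : ∀ {n} {F G : Vec ℕ n → ℕ} →
       Computable F → Computable G → Computable (λ xs → F xs ∸ G xs)
-- Recursion runs on the subtrahend, by repeated predecessors, hence the exchanged arguments.
f ∸ᶜ g = binary (λ y x → x ∸ y)
  (resp-≗ (λ where (y ∷ x ∷ []) → e y x) (primrecᶜ (var 0F) (predᶜ (var 1F)))) g f
  where
  e : ∀ y x → primrec (λ xs → lookup xs 0F) (λ xs → pred (lookup xs 1F)) y (x ∷ []) ≡ x ∸ y
  e zero    x = refl
  e (suc y) x = trans (cong pred (e y x)) (ℕ.pred[m∸n]≡m∸[1+n] x y)

triangleᶜ : ∀ {n} {F : Vec ℕ n → ℕ} → Computable F → Computable (triangle ∘ F)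
triangleᶜ = unary triangle
  (resp-≗ (λ where (x ∷ []) → e x) (primrecᶜ (constᶜ 0) (sucᶜ (var 0F) +ᶜ var 1F)))
  where
  e : ∀ x → primrec (λ _ → 0) (λ xs → suc (lookup xs 0F) + lookup xs 1F) x [] ≡ triangle x
  e zero    = refl
  e (suc x) = cong (suc x +_) (e x)

pairᶜ : ∀ {n} {F G : Vec ℕ n → ℕ} →
        Computable F → Computable G → Computable (λ xs → pair (F xs) (G xs))
pairᶜ f g = triangleᶜ (f +ᶜ g) +ᶜ g

-- Zero stands for truth, so a product is a disjunction and this is a bounded existential
-- quantifier.
∏< : ℕ → (ℕ → ℕ) → ℕ
∏< zero    h = 1
∏< (suc n) h = ∏< n h * h n

∏<-zero⁺ : ∀ n h {k} → k < n → h k ≡ 0 → ∏< n h ≡ 0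
∏<-zero⁺ (suc n) h {k} k<1+n hk≡0 with ℕ.m<1+n⇒m<n∨m≡n k<1+n
... | inj₁ k<n  = cong (_* h n) (∏<-zero⁺ n h k<n hk≡0)
... | inj₂ refl = trans (cong (∏< n h *_) hk≡0) (ℕ.*-zeroʳ (∏< n h))

∏<-zero⁻ : ∀ n h → ∏< n h ≡ 0 → ∃ λ k → h k ≡ 0
∏<-zero⁻ (suc n) h e with ℕ.m*n≡0⇒m≡0∨n≡0 (∏< n h) e
... | inj₁ e′ = ∏<-zero⁻ n h e′
... | inj₂ hn≡0 = n , hn≡0

-- Replaces two existential quantifiers by the single search variable a + b.
contract : ∀ {n} → (Vec ℕ (suc (suc n)) → ℕ) → Vec ℕ (suc n) → ℕ
contract F xs = ∏< (suc (head xs)) λ a → F (a ∷ head xs ∸ a ∷ tail xs)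

contractᶜ : ∀ {n} {F : Vec ℕ (suc (suc n)) → ℕ} → Computable F → Computable (contract F)
contractᶜ {n} {F} f =
  resp-≗ (λ where (w ∷ xs) → e (suc w) w xs)
    -- Inside the recursion, `var 0F` is the index `a`, `var 1F` the product so far and `var 2F` the
    -- search variable `w`.
    (primrecᶜ (constᶜ 1) (var 1F *ᶜ (f ∘ᶜ (var 0F ∷ᶜ (var 2F ∸ᶜ var 0F) ∷ᶜ tail³ᶜ)))
     -- The index runs from 0 to `w` inclusive, so there are `suc w` factors; `w` itself is kept as
     -- a parameter.
     ∘ᶜ (sucᶜ (var 0F) ∷ᶜ idᶜ))
  where
  e : ∀ k w xs →
      primrec (λ _ → 1)
              (λ ys → lookup ys 1F *
                      F (lookup ys 0F ∷ (lookup ys 2F ∸ lookup ys 0F) ∷ tail (tail (tail ys))))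
              k (w ∷ xs)
      ≡ ∏< k λ a → F (a ∷ w ∸ a ∷ xs)
  e zero    w xs = refl
  e (suc k) w xs = cong (_* F (k ∷ w ∸ k ∷ xs)) (e k w xs)

-- A vanishing factor at `a` gives the pair `a`, `w ∸ a`. Conversely, with `w = a + b` the index `a`
-- is in range and `w ∸ a` is `b`.
contract-∃ : ∀ {n} (F : Vec ℕ (suc (suc n)) → ℕ) xs →
             (∃ λ w → contract F (w ∷ xs) ≡ 0) ⇔ (∃₂ λ a b → F (a ∷ b ∷ xs) ≡ 0)
contract-∃ F xs = mk⇔
  (λ (w , e) → let a , e′ = ∏<-zero⁻ (suc w) _ e in a , w ∸ a , e′)
  (λ (a , b , e) → a + b ,
    ∏<-zero⁺ (suc (a + b)) _ (s≤s (ℕ.m≤m+n a b))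
      (trans (cong (λ c → F (a ∷ c ∷ xs)) (ℕ.m+n∸m≡n a b)) e))

-- `mu⇓` demands successor values below its result, so an arbitrary zero is first replaced by the
-- least one. As long as `h 0` is positive, `h` is shifted and `w` decreases.
least-zero : (h : ℕ → ℕ) → ∀ w → h w ≡ 0 →
             ∃ λ y → h y ≡ 0 × (∀ z → z < y → ∃ λ k → h z ≡ suc k)
least-zero h w hw≡0 with h 0 in e
... | zero  = 0 , e , λ _ ()
... | suc k with w
...   | zero  = contradiction (trans (sym e) hw≡0) λ ()
...   | suc w = let y , hy≡0 , below = least-zero (h ∘ suc) w hw≡0 in
  suc y , hy≡0 , λ where
    zero    _         → k , e
    (suc z) 1+z<1+y → below z (s<s⁻¹ 1+z<1+y)

mu-halts : ∀ {n F} (f : Computable {suc n} F) xs →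
           (∃ λ y → mu (program f) [ xs ]⇓ y) ⇔ (∃ λ w → F (w ∷ xs) ≡ 0)
mu-halts {F = F} (f , f⇓) xs = mk⇔
  (λ where (y , mu⇓ fy⇓0 _) → y , ⇓-deterministic (f⇓ (y ∷ xs)) fy⇓0)
  (λ (w , Fw≡0) →
    let y , Fy≡0 , below = least-zero (λ w → F (w ∷ xs)) w Fw≡0 in
    y , mu⇓ (subst (f [ y ∷ xs ]⇓_) Fy≡0 (f⇓ _))
            (λ z z<y → let k , Fz≡1+k = below z z<y in
              k , subst (f [ z ∷ xs ]⇓_) Fz≡1+k (f⇓ _)))

-- Each `contract` merges the two leading existential quantifiers, until a single variable is left
-- for `mu` to search.
semidecide : ∀ k {F : Vec ℕ (suc k + 1) → ℕ} → Computable F →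
             Σ (Rec 1) λ f → ∀ x → (∃ λ y → f [ x ∷ [] ]⇓ y) ⇔
                                    (∃ λ (v : Vec ℕ (suc k)) → F (v ++ x ∷ []) ≡ 0)
semidecide zero {F} f = mu (program f) , λ x →
  let open Equivalence (mu-halts f (x ∷ [])) in mk⇔
  (λ p → let w , e = to p in (w ∷ []) , e)
  (λ where ((w ∷ []) , e) → from (w , e))
semidecide (suc k) {F} f =
  let g , g-correct = semidecide k (contractᶜ f) in g , λ x →
  let module G = Equivalence (g-correct x) in mk⇔
  (λ p → split x (G.to p))
  (λ where ((a ∷ b ∷ v) , e) →
             let w , e′ = Equivalence.from (contract-∃ F (v ++ x ∷ [])) (a , b , e) in
             G.from ((w ∷ v) , e′))
  where
  split : ∀ x → (∃ λ (v : Vec ℕ (suc k)) → contract F (v ++ x ∷ []) ≡ 0) →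
          ∃ λ (v : Vec ℕ (suc (suc k))) → F (v ++ x ∷ []) ≡ 0
  split x ((w ∷ v) , e) =
    let a , b , e′ = Equivalence.to (contract-∃ F (v ++ x ∷ [])) (w , e) in
    (a ∷ b ∷ v) , e′

-- Gödel numbers

triangle-mono-≤ : ∀ {m n} → m ≤ n → triangle m ≤ triangle n
triangle-mono-≤ {zero}          _         = z≤n
triangle-mono-≤ {suc m} {suc n} (s≤s m≤n) = ℕ.+-mono-≤ (s≤s m≤n) (triangle-mono-≤ m≤n)

-- Pairs are numbered along diagonals of constant sum, and the diagonal of `a + b` is exhausted
-- before `triangle (suc (a + b))`.
pair-mono-< : ∀ a b c d → a + b < c + d → pair a b < pair c d
pair-mono-< a b c d a+b<c+d = begin-strict
  triangle (a + b) + b            <⟨ ℕ.+-monoʳ-< (triangle (a + b)) (s≤s (ℕ.m≤n+m b a)) ⟩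
  triangle (a + b) + suc (a + b)  ≡⟨ ℕ.+-comm (triangle (a + b)) _ ⟩
  triangle (suc (a + b))          ≤⟨ triangle-mono-≤ a+b<c+d ⟩
  triangle (c + d)                ≤⟨ ℕ.m≤m+n _ d ⟩
  triangle (c + d) + d            ∎
  where open ℕ.≤-Reasoning

-- Different sums put the codes on different diagonals; within one diagonal the second component is
-- the offset.
pair-injective : ∀ a b c d → pair a b ≡ pair c d → a ≡ c × b ≡ d
pair-injective a b c d e with ℕ.<-cmp (a + b) (c + d)
... | tri< s<t _ _ = contradiction e (ℕ.<⇒≢ (pair-mono-< a b c d s<t))
... | tri> _ _ t<s = contradiction (sym e) (ℕ.<⇒≢ (pair-mono-< c d a b t<s))
... | tri≈ _ s≡t _ = ℕ.+-cancelʳ-≡ b a c (trans s≡t (cong (c +_) (sym b≡d))) , b≡d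
  where
  b≡d : b ≡ d
  b≡d = ℕ.+-cancelˡ-≡ (triangle (a + b)) b d (trans e (cong (λ t → triangle t + d) (sym s≡t)))

codeAtom-injective : ∀ {φ ψ} → codeAtom φ ≡ codeAtom ψ → φ ≡ ψ
codeAtom-injective {lt a b} {lt c d} e =
  uncurry (cong₂ lt) (pair-injective a b c d (proj₂ (pair-injective 0 (pair a b) 0 (pair c d) e)))
codeAtom-injective {eq a b} {eq c d} e =
  uncurry (cong₂ eq) (pair-injective a b c d (proj₂ (pair-injective 1 (pair a b) 1 (pair c d) e)))
codeAtom-injective {lt a b} {eq c d} e
  with () ← proj₁ (pair-injective 0 (pair a b) 1 (pair c d) e)
codeAtom-injective {eq a b} {lt c d} e
  with () ← proj₁ (pair-injective 1 (pair a b) 0 (pair c d) e)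

codeBasic-injective : ∀ {φ ψ} → codeBasic φ ≡ codeBasic ψ → φ ≡ ψ
codeBasic-injective {pos φ} {pos ψ} e =
  cong pos (codeAtom-injective (proj₂ (pair-injective 0 (codeAtom φ) 0 (codeAtom ψ) e)))
codeBasic-injective {neg φ} {neg ψ} e =
  cong neg (codeAtom-injective (proj₂ (pair-injective 1 (codeAtom φ) 1 (codeAtom ψ) e)))
codeBasic-injective {pos φ} {neg ψ} e
  with () ← proj₁ (pair-injective 0 (codeAtom φ) 1 (codeAtom ψ) e)
codeBasic-injective {neg φ} {pos ψ} e
  with () ← proj₁ (pair-injective 1 (codeAtom φ) 0 (codeAtom ψ) e)

codeList-injective : ∀ {α β} → codeList α ≡ codeList β → α ≡ β
codeList-injective {[]}    {[]}    _ = refl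
codeList-injective {φ ∷ α} {ψ ∷ β} e =
  let φ≡ψ , α≡β = pair-injective (codeBasic φ) (codeList α) (codeBasic ψ) (codeList β)
                                 (ℕ.suc-injective e) in
  cong₂ _∷_ (codeBasic-injective φ≡ψ) (codeList-injective α≡β)

codeRule-injective : ∀ {r s} → codeRule r ≡ codeRule s → r ≡ s
codeRule-injective {α , φ} {β , ψ} e =
  let α≡β , φ≡ψ = pair-injective (codeList α) (codeBasic φ) (codeList β) (codeBasic ψ) e in
  cong₂ _,_ (codeList-injective α≡β) (codeBasic-injective φ≡ψ)

-- The absolute difference, by truncated subtraction; it expresses equality as the vanishing of a
-- computable function.
dist : ℕ → ℕ → ℕ
dist x y = (x ∸ y) + (y ∸ x)

dist-refl : ∀ x → dist x x ≡ 0
dist-refl x = cong₂ _+_ (ℕ.n∸n≡0 x) (ℕ.n∸n≡0 x)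

dist≡0⇒≡ : ∀ x {y} → dist x y ≡ 0 → x ≡ y
dist≡0⇒≡ x {y} e = ℕ.≤-antisym
  (ℕ.m∸n≡0⇒m≤n (ℕ.m+n≡0⇒m≡0 (x ∸ y) e))
  (ℕ.m∸n≡0⇒m≤n (ℕ.m+n≡0⇒n≡0 (x ∸ y) e))

Rule : Set
Rule = List Basic × Basic

-- Again a product serves as a disjunction, here for membership in a finite list.
∏dist : List Rule → ℕ → ℕ
∏dist rs x = product (map (λ r → dist (codeRule r) x) rs)

∏dist-zero : ∀ rs r → (∏dist rs (codeRule r) ≡ 0) ⇔ (r ∈ₗ rs)
∏dist-zero rs r = mk⇔ (to rs) (from rs)
  where
  to : ∀ rs → ∏dist rs (codeRule r) ≡ 0 → r ∈ₗ rs
  to (s ∷ rs) e with ℕ.m*n≡0⇒m≡0∨n≡0 (dist (codeRule s) (codeRule r)) e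
  ... | inj₁ e′ = here (sym (codeRule-injective (dist≡0⇒≡ (codeRule s) e′)))
  ... | inj₂ e′ = there (to rs e′)

  from : ∀ rs → r ∈ₗ rs → ∏dist rs (codeRule r) ≡ 0
  from (_ ∷ rs) (here refl) = cong (_* ∏dist rs (codeRule r)) (dist-refl (codeRule r))
  from (s ∷ rs) (there r∈)  =
    trans (cong (dist (codeRule s) (codeRule r) *_) (from rs r∈))
          (ℕ.*-zeroʳ (dist (codeRule s) (codeRule r)))

-- The squaring operator

-- A premise eq b b only says that b belongs to the domain.
schemes : (a b c d : ℕ) → List Rule
schemes a b c d =
    (pos (lt a c) ∷ pos (eq b b) ∷ pos (eq d d) ∷ [] , pos (lt x y))
  ∷ (pos (eq a c) ∷ pos (lt b d)                ∷ [] , pos (lt x y))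
  ∷ (pos (lt c a) ∷ pos (eq b b) ∷ pos (eq d d) ∷ [] , neg (lt x y))
  ∷ (pos (eq a c) ∷ neg (lt b d)                ∷ [] , neg (lt x y))
  ∷ (pos (eq a c) ∷ pos (eq b d)                ∷ [] , pos (eq x y))
  ∷ (neg (eq a c) ∷ pos (eq b b) ∷ pos (eq d d) ∷ [] , neg (eq x y))
  ∷ (neg (eq b d) ∷ pos (eq a a) ∷ pos (eq c c) ∷ [] , neg (eq x y))
  ∷ []
  where
  x = pair a b
  y = pair c d

ltᶜ : ∀ {n} {F G : Vec ℕ n → ℕ} → Computable F → Computable G →
      Computable (λ xs → codeAtom (lt (F xs) (G xs)))
ltᶜ f g = pairᶜ (constᶜ 0) (pairᶜ f g)

eqᶜ : ∀ {n} {F G : Vec ℕ n → ℕ} → Computable F → Computable G →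
      Computable (λ xs → codeAtom (eq (F xs) (G xs)))
eqᶜ f g = pairᶜ (constᶜ 1) (pairᶜ f g)

posᶜ : ∀ {n} {φ : Vec ℕ n → ℕ} → Computable φ → Computable (λ xs → pair 0 (φ xs))
posᶜ = pairᶜ (constᶜ 0)

negᶜ : ∀ {n} {φ : Vec ℕ n → ℕ} → Computable φ → Computable (λ xs → pair 1 (φ xs))
negᶜ = pairᶜ (constᶜ 1)

nilᶜ : ∀ {n} → Computable {n} (λ _ → codeList [])
nilᶜ = constᶜ 0

infixr 5 _∷ˡ_

_∷ˡ_ : ∀ {n} {F G : Vec ℕ n → ℕ} → Computable F → Computable G →
       Computable (λ xs → suc (pair (F xs) (G xs)))
f ∷ˡ g = sucᶜ (pairᶜ f g)

distᶜ : ∀ {n} {F G : Vec ℕ n → ℕ} → Computable F → Computable G →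
        Computable (λ xs → dist (F xs) (G xs))
distᶜ f g = (f ∸ᶜ g) +ᶜ (g ∸ᶜ f)

-- Mirrors `schemes` rule by rule, so that the two agree by unfolding. The fifth variable is the
-- code under test, and the last factor 1 is the product of the empty list.
schemesᶜ : Computable λ xs →
  ∏dist (schemes (lookup xs 0F) (lookup xs 1F) (lookup xs 2F) (lookup xs 3F)) (lookup xs 4F)
schemesᶜ =
     rule (posᶜ (ltᶜ a c) ∷ˡ posᶜ (eqᶜ b b) ∷ˡ posᶜ (eqᶜ d d) ∷ˡ nilᶜ) (posᶜ (ltᶜ x y))
  *ᶜ (rule (posᶜ (eqᶜ a c) ∷ˡ posᶜ (ltᶜ b d)                  ∷ˡ nilᶜ) (posᶜ (ltᶜ x y))
  *ᶜ (rule (posᶜ (ltᶜ c a) ∷ˡ posᶜ (eqᶜ b b) ∷ˡ posᶜ (eqᶜ d d) ∷ˡ nilᶜ) (negᶜ (ltᶜ x y))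
  *ᶜ (rule (posᶜ (eqᶜ a c) ∷ˡ negᶜ (ltᶜ b d)                  ∷ˡ nilᶜ) (negᶜ (ltᶜ x y))
  *ᶜ (rule (posᶜ (eqᶜ a c) ∷ˡ posᶜ (eqᶜ b d)                  ∷ˡ nilᶜ) (posᶜ (eqᶜ x y))
  *ᶜ (rule (negᶜ (eqᶜ a c) ∷ˡ posᶜ (eqᶜ b b) ∷ˡ posᶜ (eqᶜ d d) ∷ˡ nilᶜ) (negᶜ (eqᶜ x y))
  *ᶜ (rule (negᶜ (eqᶜ b d) ∷ˡ posᶜ (eqᶜ a a) ∷ˡ posᶜ (eqᶜ c c) ∷ˡ nilᶜ) (negᶜ (eqᶜ x y))
  *ᶜ constᶜ 1))))))
  where
  a = var {5} 0F
  b = var {5} 1F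
  c = var {5} 2F
  d = var {5} 3F
  x = pairᶜ a b
  y = pairᶜ c d

  rule : ∀ {F G : Vec ℕ 5 → ℕ} → Computable F → Computable G →
         Computable (λ xs → dist (pair (F xs) (G xs)) (lookup xs 4F))
  rule α φ = distᶜ (pairᶜ α φ) (var 4F)

squareOperator : EnumerationOperator
squareOperator .rules r = ∃₂ λ a b → ∃₂ λ c d → r ∈ₗ schemes a b c d
squareOperator .ce =
  -- The argument 3 stands for the four quantified parameters `a`, `b`, `c`, `d`.
  let f , f-correct = semidecide 3 schemesᶜ in f ,
  (λ {r} (a , b , c , d , r∈) → Equivalence.from (f-correct (codeRule r))
    ((a ∷ b ∷ c ∷ d ∷ []) , Equivalence.from (∏dist-zero (schemes a b c d) r) r∈)) ,
  (λ {r} p → sound r (Equivalence.to (f-correct (codeRule r)) p))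
  where
  sound : ∀ r → (∃ λ v → _) → rules squareOperator r
  sound r ((a ∷ b ∷ c ∷ d ∷ []) , e) =
    a , b , c , d , Equivalence.to (∏dist-zero (schemes a b c d) r) e

-- Quantifying over coordinates takes the place of an inverse of `pair`.
square : Structure → Structure
square 𝓐 .Dom x = ∃₂ λ a b → x ≡ pair a b × Dom 𝓐 a × Dom 𝓐 b
square 𝓐 .Less x y = ∃₂ λ p q →
  x ≡ uncurry pair p × y ≡ uncurry pair q × ×-Lex _≡_ (Less 𝓐) (Less 𝓐) p q

square-Less⁻ : ∀ 𝓐 a b c d → Less (square 𝓐) (pair a b) (pair c d) →
               ×-Lex _≡_ (Less 𝓐) (Less 𝓐) (a , b) (c , d)
square-Less⁻ 𝓐 a b c d ((a′ , b′) , (c′ , d′) , e₁ , e₂ , p<q)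
  with refl , refl ← pair-injective a b a′ b′ e₁
     | refl , refl ← pair-injective c d c′ d′ e₂ = p<q

module _ (𝓐 : Structure) (L : LinearOrder)
         (𝓐≅L : rawRelation 𝓐 ≅ StrictTotalOrder.rawRelation L) where

  -- The order of `L` pulled back to the elements of `𝓐`; it supplies the trichotomy and asymmetry
  -- used in `squareOperator-correct`.
  order : LinearOrder
  order = record
    { isStrictTotalOrder = OrderMonomorphism.isStrictTotalOrder
        (IsOrderIsomorphism.isOrderMonomorphism (proj₂ 𝓐≅L))
        (StrictTotalOrder.isStrictTotalOrder L)
    }

  private module A = StrictTotalOrder order

  -- `f` reads the coordinates off the proof of membership in the domain; `pair-injective` makes
  -- them depend on the code alone.
  square≅order² : rawRelation (square 𝓐) ≅ StrictTotalOrder.rawRelation (order · order)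
  square≅order² = f , record
    { isOrderMonomorphism = record
      { isOrderHomomorphism = record
        { cong = λ {x} {y} → cong-f {x} {y} ; mono = λ {x} {y} → mono {x} {y} }
      ; injective = λ {x} {y} → injective {x} {y}
      ; cancel = λ {x} {y} → cancel {x} {y}
      }
    ; surjective = λ ((a , a∈) , (b , b∈)) →
        let x = pair a b , a , b , refl , a∈ , b∈ in x , λ {z} → cong-f {z} {x}
    }
    where
    open RawRelation (rawRelation (square 𝓐)) using (Carrier; _≈_; _∼_)
    module A² = StrictTotalOrder (order · order)

    f : Carrier → A².Carrier
    f (_ , a , b , _ , a∈ , b∈) = (a , a∈) , (b , b∈)

    cong-f : f Preserves _≈_ ⟶ A²._≈_
    cong-f {_ , a , b , refl , _} {_ , c , d , refl , _} = pair-injective a b c d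

    mono : f Preserves _∼_ ⟶ A²._<_
    mono {_ , a , b , refl , _} {_ , c , d , refl , _} = square-Less⁻ 𝓐 a b c d

    injective : ∀ {x y} → f x A².≈ f y → x ≈ y
    injective {_ , _ , _ , refl , _} {_ , _ , _ , refl , _} (refl , refl) = refl

    cancel : ∀ {x y} → f x A².< f y → x ∼ y
    cancel {_ , _ , _ , refl , _} {_ , _ , _ , refl , _} p<q = _ , _ , refl , refl , p<q

  square≅ : rawRelation (square 𝓐) ≅ StrictTotalOrder.rawRelation (L · L)
  square≅ = ≅-trans (StrictTotalOrder.Eq.trans (L · L)) square≅order²
                    (·-cong order L order L 𝓐≅L 𝓐≅L)

  -- Soundness goes through the seven rules in turn. Completeness finds a rule for each true basic
  -- sentence, where the negated ones need a case distinction.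
  squareOperator-correct : squareOperator ∶ 𝓐 ↦ square 𝓐
  squareOperator-correct = (λ {φ} (α , (a , b , c , d , r∈) , α⊆) → sound r∈ α⊆) , λ {φ} → complete φ
    where
    sound : ∀ {a b c d α φ} → (α , φ) ∈ₗ schemes a b c d →
            All (Diagram 𝓐) α → Diagram (square 𝓐) φ
    sound {a} {b} {c} {d} (here refl) (((a∈ , c∈) , a<c) ∷ ((b∈ , _) , _) ∷ ((d∈ , _) , _) ∷ []) =
      ((a , b , refl , a∈ , b∈) , (c , d , refl , c∈ , d∈)) ,
      (a , b) , (c , d) , refl , refl , inj₁ a<c
    sound {a} {b} {c} {d} (there (here refl)) (((a∈ , c∈) , a≡c) ∷ ((b∈ , d∈) , b<d) ∷ []) =
      ((a , b , refl , a∈ , b∈) , (c , d , refl , c∈ , d∈)) ,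
      (a , b) , (c , d) , refl , refl , inj₂ (a≡c , b<d)
    sound {a} {b} {c} {d} (there (there (here refl)))
          (((c∈ , a∈) , c<a) ∷ ((b∈ , _) , _) ∷ ((d∈ , _) , _) ∷ []) =
      ((a , b , refl , a∈ , b∈) , (c , d , refl , c∈ , d∈)) , case ∘ square-Less⁻ 𝓐 a b c d
      where
      -- `c < a` excludes both ways of being lexicographically smaller.
      case : ¬ ×-Lex _≡_ (Less 𝓐) (Less 𝓐) (a , b) (c , d)
      case (inj₁ a<c)       = A.asym {a , a∈} {c , c∈} a<c c<a
      case (inj₂ (a≡c , _)) = A.irrefl {c , c∈} {a , a∈} (sym a≡c) c<a
    sound {a} {b} {c} {d} (there (there (there (here refl))))
          (((a∈ , c∈) , a≡c) ∷ ((b∈ , d∈) , b≮d) ∷ []) =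
      ((a , b , refl , a∈ , b∈) , (c , d , refl , c∈ , d∈)) , case ∘ square-Less⁻ 𝓐 a b c d
      where
      case : ¬ ×-Lex _≡_ (Less 𝓐) (Less 𝓐) (a , b) (c , d)
      case (inj₁ a<c)       = A.irrefl {a , a∈} {c , c∈} a≡c a<c
      case (inj₂ (_ , b<d)) = b≮d b<d
    sound {a} {b} {c} {d} (there (there (there (there (here refl)))))
          (((a∈ , c∈) , a≡c) ∷ ((b∈ , d∈) , b≡d) ∷ []) =
      ((a , b , refl , a∈ , b∈) , (c , d , refl , c∈ , d∈)) , cong₂ pair a≡c b≡d
    sound {a} {b} {c} {d} (there (there (there (there (there (here refl))))))
          (((a∈ , c∈) , a≢c) ∷ ((b∈ , _) , _) ∷ ((d∈ , _) , _) ∷ []) =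
      ((a , b , refl , a∈ , b∈) , (c , d , refl , c∈ , d∈)) , a≢c ∘ proj₁ ∘ pair-injective a b c d
    sound {a} {b} {c} {d} (there (there (there (there (there (there (here refl)))))))
          (((b∈ , d∈) , b≢d) ∷ ((a∈ , _) , _) ∷ ((c∈ , _) , _) ∷ []) =
      ((a , b , refl , a∈ , b∈) , (c , d , refl , c∈ , d∈)) , b≢d ∘ proj₂ ∘ pair-injective a b c d

    by : ∀ a b c d {α φ} → (α , φ) ∈ₗ schemes a b c d → All (Diagram 𝓐) α →
         apply squareOperator (Diagram 𝓐) φ
    by a b c d r∈ α⊆ = _ , (a , b , c , d , r∈) , α⊆

    complete : ∀ φ → Diagram (square 𝓐) φ → apply squareOperator (Diagram 𝓐) φ
    complete (pos (lt _ _)) (((a , b , refl , a∈ , b∈) , (c , d , refl , c∈ , d∈)) , x<y)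
      with square-Less⁻ 𝓐 a b c d x<y
    ... | inj₁ a<c = by a b c d (here refl)
            (((a∈ , c∈) , a<c) ∷ ((b∈ , b∈) , refl) ∷ ((d∈ , d∈) , refl) ∷ [])
    ... | inj₂ (a≡c , b<d) = by a b c d (there (here refl))
            (((a∈ , c∈) , a≡c) ∷ ((b∈ , d∈) , b<d) ∷ [])
    complete (neg (lt _ _)) (((a , b , refl , a∈ , b∈) , (c , d , refl , c∈ , d∈)) , x≮y)
      -- The rules for a failing comparison ask for `c < a` or `a ≡ c`; trichotomy decides which
      -- applies.
      with A.compare (a , a∈) (c , c∈)
    ... | tri< a<c _ _ = contradiction ((a , b) , (c , d) , refl , refl , inj₁ a<c) x≮y
    ... | tri≈ _ a≡c _ = by a b c d (there (there (there (here refl))))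
            (((a∈ , c∈) , a≡c) ∷
             ((b∈ , d∈) , λ b<d → x≮y ((a , b) , (c , d) , refl , refl , inj₂ (a≡c , b<d))) ∷ [])
    ... | tri> _ _ c<a = by a b c d (there (there (here refl)))
            (((c∈ , a∈) , c<a) ∷ ((b∈ , b∈) , refl) ∷ ((d∈ , d∈) , refl) ∷ [])
    complete (pos (eq _ _)) (((a , b , refl , a∈ , b∈) , (c , d , refl , c∈ , d∈)) , x≡y) =
      let a≡c , b≡d = pair-injective a b c d x≡y in
      by a b c d (there (there (there (there (here refl)))))
        (((a∈ , c∈) , a≡c) ∷ ((b∈ , d∈) , b≡d) ∷ [])
    complete (neg (eq _ _)) (((a , b , refl , a∈ , b∈) , (c , d , refl , c∈ , d∈)) , x≢y)
      -- If `a` and `c` agree, the codes can differ only through `b` and `d`.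
      with a ℕ.≟ c
    ... | no a≢c  = by a b c d (there (there (there (there (there (here refl))))))
            (((a∈ , c∈) , a≢c) ∷ ((b∈ , b∈) , refl) ∷ ((d∈ , d∈) , refl) ∷ [])
    ... | yes a≡c = by a b c d (there (there (there (there (there (there (here refl)))))))
            (((b∈ , d∈) , (λ b≡d → x≢y (cong₂ pair a≡c b≡d))) ∷
             ((a∈ , a∈) , refl) ∷ ((c∈ , c∈) , refl) ∷ [])

-- Embeddings between classes of two order types

-- The identity on numbers serves, because the sentence `eq a a` is in a diagram exactly when `a` is
-- in the domain.
Diagram-≐⇒≅ : ∀ 𝓐 𝓑 → Diagram 𝓐 ≐ Diagram 𝓑 → rawRelation 𝓐 ≅ rawRelation 𝓑
Diagram-≐⇒≅ 𝓐 𝓑 (𝓐⊆𝓑 , 𝓑⊆𝓐) =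
  (λ (a , a∈) → a , Dom⊆ a∈) , record
  { isOrderMonomorphism = record
    { isOrderHomomorphism = record
      { cong = id
      ; mono = λ {(a , a∈)} {(b , b∈)} a<b → proj₂ (𝓐⊆𝓑 {pos (lt a b)} ((a∈ , b∈) , a<b))
      }
    ; injective = id
    ; cancel = λ {(a , a∈)} {(b , b∈)} a<b →
        proj₂ (𝓑⊆𝓐 {pos (lt a b)} ((Dom⊆ a∈ , Dom⊆ b∈) , a<b))
    }
  ; surjective = λ (b , b∈) → (b , proj₁ (proj₁ (𝓑⊆𝓐 {pos (eq b b)} ((b∈ , b∈) , refl)))) , id
  }
  where
  Dom⊆ : ∀ {a} → Dom 𝓐 a → Dom 𝓑 a
  Dom⊆ {a} a∈ = proj₁ (proj₁ (𝓐⊆𝓑 {pos (eq a a)} ((a∈ , a∈) , refl)))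

infix 4 _≅ₛ_

_≅ₛ_ : Structure → LinearOrder → Set
𝓐 ≅ₛ L = rawRelation 𝓐 ≅ StrictTotalOrder.rawRelation L

same-type : ∀ 𝓐 𝓑 L → 𝓐 ≅ₛ L → 𝓑 ≅ₛ L → rawRelation 𝓐 ≅ rawRelation 𝓑
same-type 𝓐 𝓑 L 𝓐≅L 𝓑≅L = ≅-trans trans 𝓐≅L (≅-sym L 𝓑≅L)

≄⇒≇ : ∀ 𝓐 𝓑 L M → ¬ L ≃ M → 𝓐 ≅ₛ L → 𝓑 ≅ₛ M → ¬ rawRelation 𝓐 ≅ rawRelation 𝓑
≄⇒≇ 𝓐 𝓑 L M L≄M 𝓐≅L 𝓑≅M 𝓐≅𝓑 =
  L≄M (≅-trans trans-M (≅-trans trans (≅-sym L 𝓐≅L) 𝓐≅𝓑) 𝓑≅M)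
  where
  trans-M = λ {x} {y} {z} → StrictTotalOrder.Eq.trans M {x} {y} {z}

≅ₛ-resp-≅ : ∀ 𝓐 𝓑 L → 𝓐 ≅ₛ L → rawRelation 𝓑 ≅ rawRelation 𝓐 → 𝓑 ≅ₛ L
≅ₛ-resp-≅ 𝓐 𝓑 L 𝓐≅L 𝓑≅𝓐 = ≅-trans (StrictTotalOrder.Eq.trans L) 𝓑≅𝓐 𝓐≅L

_Sends_To_ : EnumerationOperator → LinearOrder → LinearOrder → Set₁
Γ Sends L To L′ = ∀ 𝓐 → 𝓐 ≅ₛ L → ∃ λ 𝓑 → 𝓑 ≅ₛ L′ × Γ ∶ 𝓐 ↦ 𝓑

module _ (Γ : EnumerationOperator) (L M L′ M′ : LinearOrder)
         (L≄M : ¬ L ≃ M) (L′≄M′ : ¬ L′ ≃ M′)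
         (ΓL : Γ Sends L To L′) (ΓM : Γ Sends M To M′) where

  private
    -- `invariant` allows any `𝓒` that presents the output, whereas `ΓK` yields one particular `𝓑`;
    -- their diagrams coincide.
    image-type : ∀ K K′ → Γ Sends K To K′ → ∀ 𝓐 𝓒 → 𝓐 ≅ₛ K → Γ ∶ 𝓐 ↦ 𝓒 → 𝓒 ≅ₛ K′
    image-type K K′ ΓK 𝓐 𝓒 𝓐≅K (Γ𝓐⊆𝓒 , 𝓒⊆Γ𝓐) =
      let 𝓑 , 𝓑≅K′ , (Γ𝓐⊆𝓑 , 𝓑⊆Γ𝓐) = ΓK 𝓐 𝓐≅K in
      ≅ₛ-resp-≅ 𝓑 𝓒 K′ 𝓑≅K′
        (Diagram-≐⇒≅ 𝓒 𝓑 ((λ {φ} p → Γ𝓐⊆𝓑 {φ} (𝓒⊆Γ𝓐 {φ} p)) , (λ {φ} p → Γ𝓐⊆𝓒 {φ} (𝓑⊆Γ𝓐 {φ} p))))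

  isComputableEmbedding : IsComputableEmbedding Γ ｛ L , M ｝ ｛ L′ , M′ ｝
  isComputableEmbedding = record
    { image = λ where
        𝓐 (inj₁ 𝓐≅L) → let 𝓑 , 𝓑≅L′ , Γ𝓐 = ΓL 𝓐 𝓐≅L in 𝓑 , inj₁ 𝓑≅L′ , Γ𝓐
        𝓐 (inj₂ 𝓐≅M) → let 𝓑 , 𝓑≅M′ , Γ𝓐 = ΓM 𝓐 𝓐≅M in 𝓑 , inj₂ 𝓑≅M′ , Γ𝓐
    ; invariant = λ where
        𝓐 𝓑 (inj₁ 𝓐≅L) (inj₁ 𝓑≅L) 𝓒 𝓓 Γ𝓐 Γ𝓑 → mk⇔
          (λ _ → same-type 𝓒 𝓓 L′ (typeL 𝓐 𝓒 𝓐≅L Γ𝓐) (typeL 𝓑 𝓓 𝓑≅L Γ𝓑))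
          (λ _ → same-type 𝓐 𝓑 L 𝓐≅L 𝓑≅L)
        𝓐 𝓑 (inj₂ 𝓐≅M) (inj₂ 𝓑≅M) 𝓒 𝓓 Γ𝓐 Γ𝓑 → mk⇔
          (λ _ → same-type 𝓒 𝓓 M′ (typeM 𝓐 𝓒 𝓐≅M Γ𝓐) (typeM 𝓑 𝓓 𝓑≅M Γ𝓑))
          (λ _ → same-type 𝓐 𝓑 M 𝓐≅M 𝓑≅M)
        -- In the mixed cases neither isomorphism exists, so each direction starts from a
        -- contradiction.
        𝓐 𝓑 (inj₁ 𝓐≅L) (inj₂ 𝓑≅M) 𝓒 𝓓 Γ𝓐 Γ𝓑 → mk⇔
          (λ 𝓐≅𝓑 → contradiction 𝓐≅𝓑 (≄⇒≇ 𝓐 𝓑 L M L≄M 𝓐≅L 𝓑≅M))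
          (λ 𝓒≅𝓓 → contradiction 𝓒≅𝓓
            (≄⇒≇ 𝓒 𝓓 L′ M′ L′≄M′ (typeL 𝓐 𝓒 𝓐≅L Γ𝓐) (typeM 𝓑 𝓓 𝓑≅M Γ𝓑)))
        𝓐 𝓑 (inj₂ 𝓐≅M) (inj₁ 𝓑≅L) 𝓒 𝓓 Γ𝓐 Γ𝓑 → mk⇔
          (λ 𝓐≅𝓑 → contradiction 𝓐≅𝓑
            (≄⇒≇ 𝓐 𝓑 M L (L≄M ∘ ≅-sym L) 𝓐≅M 𝓑≅L))
          (λ 𝓒≅𝓓 → contradiction 𝓒≅𝓓
            (≄⇒≇ 𝓒 𝓓 M′ L′ (L′≄M′ ∘ ≅-sym L′) (typeM 𝓐 𝓒 𝓐≅M Γ𝓐) (typeL 𝓑 𝓓 𝓑≅L Γ𝓑)))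
    }
    where
    typeL = image-type L L′ ΓL
    typeM = image-type M M′ ΓM

squareOperator-sends : ∀ K K′ → K · K ≃ K′ → squareOperator Sends K To K′
squareOperator-sends K K′ K²≃K′ 𝓐 𝓐≅K =
  square 𝓐 ,
  ≅-trans (StrictTotalOrder.Eq.trans K′) (square≅ 𝓐 K 𝓐≅K) K²≃K′ ,
  squareOperator-correct 𝓐 K 𝓐≅K

theorem3p1 : (n : ℕ) → n ≥ 1 →
    ｛ ω · finite n , ω ⋆ · finite n ｝ ≤c ｛ ω² · finite n , ω² ⋆ · finite n ｝
theorem3p1 n@(suc m) _ = squareOperator ,
  isComputableEmbedding squareOperator
    (ω · finite n) (ω ⋆ · finite n) (ω² · finite n) (ω² ⋆ · finite n)
    (ω·n≄ω⋆·n m) (ω²·n≄ω²⋆·n m)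
    (squareOperator-sends (ω · finite n) (ω² · finite n)
      (square-≃ ω (finite n) (finite·ω≃ω m)))
    (squareOperator-sends (ω ⋆ · finite n) (ω² ⋆ · finite n)
      -- Squaring produces `ω ⋆ · ω ⋆` in each copy, which `⋆-·` turns into `ω² ⋆`.
      (≃-trans ((ω ⋆ · finite n) · (ω ⋆ · finite n)) (ω ⋆ · ω ⋆ · finite n) (ω² ⋆ · finite n)
        (square-≃ (ω ⋆) (finite n) (finite·ω⋆≃ω⋆ m))
        (·-cong (ω ⋆ · ω ⋆) (ω² ⋆) (finite n) (finite n) (⋆-· ω ω) (≃-refl (finite n)))))
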